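{- Let $k,l\ge 2$ be integers such that $k-1$ is divisible by $l-1$. Then every $\mathcal{C}^B_{2k}$-free ordered graph $G$ has a $\mathcal{C}^B_{2l}$-free subgraph (with the vertex ordering inherited from $G$) with at least $\frac{l-1}{k-1}\,|E(G)|$ edges.
   Context: An ordered graph is a finite simple graph together with a linear ordering of its vertex set. An ordered graph $G$ contains an ordered graph $H$ as an ordered subgraph if there is an injective, order-preserving map from the vertices of $H$ to the vertices of $G$ that maps edges of $H$ to edges of $G$ (the copy need not be induced). For a set $\mathcal{H}$ of ordered graphs, $G$ is $\mathcal{H}$-free if it contains no $H\in\mathcal{H}$ as an ordered subgraph. The interval chromatic number of an ordered graph is the minimum number of intervals into which its linearly ordered vertex set can be partitioned so that no two vertices in the same interval are adjacent. In an ordered graph with interval chromatic number $2$ and intervals $U$ and $V$ ($U$ preceding $V$), an edge joining the first vertex of $U$ to the last vertex of $V$ is called an outer border, and an edge joining the last vertex of $U$ to the first vertex of $V$ is called an inner border. A bordered cycle is an ordered cycle (an ordered graph whose underlying graph is a cycle) with interval chromatic number $2$ that contains both an inner border and an outer border. $\mathcal{C}^B_{2j}$ is the set of all bordered cycles of length $2j$ (up to order-preserving isomorphism). -}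

module Defs where

open import Data.Nat.Base as ℕ using (ℕ)
open import Data.Fin.Base using (Fin; zero; suc; toℕ; _≤_)
open import Data.Fin.Properties using (_<?_)
open import Data.List.Base using (List; allFin; cartesianProduct; filter; length)
open import Data.Product.Base using (_×_; _,_; Σ-syntax; ∃-syntax)
open import Data.Sum.Base using (_⊎_)
open import Function.Bundles using (_↔_; _⇔_; Inverse)
open import Function.Definitions using (Injective; StrictlySurjective)
open import Level using (0ℓ)
open import Relation.Binary.Core using (Rel; _Preserves_⟶_)
open import Relation.Binary.Definitions using (Decidable; Symmetric; Irreflexive)
open import Relation.Binary.PropositionalEquality.Core using (_≡_)
open import Relation.Nullary.Decidable.Core using (_×-dec_)
open import Relation.Nullary.Negation.Core using (¬_)
open import Relation.Unary using (Pred)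

-- A finite linear order is uniquely isomorphic to some Fin n with its usual
-- order, so the vertex set is taken to be Fin n.
record OrderedGraph : Set₁ where
  field
    order  : ℕ
    Adj    : Rel (Fin order) 0ℓ
    adj?   : Decidable Adj
    sym    : Symmetric Adj
    irrefl : Irreflexive _≡_ Adj

  Vertex : Set
  Vertex = Fin order

  -- Each edge is listed once, smaller endpoint first.
  edges : List (Vertex × Vertex)
  edges = filter (λ (u , v) → (u <? v) ×-dec adj? u v)
                 (cartesianProduct (allFin order) (allFin order))

  #edges : ℕ
  #edges = length edges

open OrderedGraph public using (order; Vertex; #edges)

infix 4 _⊑_

-- H ⊑ G: G contains H as a (not necessarily induced) ordered subgraph.
-- Equivalently, H is, up to order-preserving isomorphism, a subgraph of G
-- with the inherited vertex ordering.
_⊑_ : OrderedGraph → OrderedGraph → Set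
H ⊑ G = Σ[ f ∈ (Vertex H → Vertex G) ]
    Injective _≡_ _≡_ f
  × f Preserves _≤_ ⟶ _≤_
  × f Preserves H.Adj ⟶ G.Adj
  where
  module H = OrderedGraph H
  module G = OrderedGraph G

_-Free : Pred OrderedGraph 0ℓ → OrderedGraph → Set₁
(𝓗 -Free) G = ∀ H → 𝓗 H → ¬ (H ⊑ G)

CycleAdj : ∀ {n} → Rel (Fin n) 0ℓ
CycleAdj {n} i j = Next i j ⊎ Next j i
  where
  Next : Rel (Fin n) 0ℓ
  Next i j = (ℕ.suc (toℕ i) ≡ toℕ j) ⊎ (ℕ.suc (toℕ i) ≡ n × toℕ j ≡ 0)

-- The underlying graph is a cycle; the enumeration σ along the cycle is
-- unrelated to the vertex ordering.
IsCycle : OrderedGraph → Set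
IsCycle G = 3 ℕ.≤ order G ×
  (Σ[ σ ∈ Vertex G ↔ Vertex G ]
    (∀ i j → CycleAdj i j ⇔ G.Adj (Inverse.to σ i) (Inverse.to σ j)))
  where module G = OrderedGraph G

-- A partition into c nonempty independent intervals.  The intervals are the
-- fibres of `part`, numbered from left to right.
record IntervalPartition (G : OrderedGraph) (c : ℕ) : Set where
  open OrderedGraph G using (Adj)
  field
    part        : Vertex G → Fin c
    monotone    : part Preserves _≤_ ⟶ _≤_
    nonempty    : StrictlySurjective _≡_ part
    independent : ∀ {u v} → part u ≡ part v → ¬ Adj u v

  IsFirst : Fin c → Vertex G → Set
  IsFirst i u = part u ≡ i × (∀ w → part w ≡ i → u ≤ w)

  IsLast : Fin c → Vertex G → Set
  IsLast i u = part u ≡ i × (∀ w → part w ≡ i → w ≤ u)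

HasIntervalChromaticNumber : OrderedGraph → ℕ → Set
HasIntervalChromaticNumber G c =
  IntervalPartition G c × (∀ d → IntervalPartition G d → c ℕ.≤ d)

module _ {G : OrderedGraph} (P : IntervalPartition G 2) where
  open OrderedGraph G using (Adj)
  open IntervalPartition P

  private
    U V : Fin 2
    U = zero
    V = suc zero

  HasOuterBorder : Set
  HasOuterBorder = ∃[ u ] ∃[ v ] IsFirst U u × IsLast V v × Adj u v

  HasInnerBorder : Set
  HasInnerBorder = ∃[ u ] ∃[ v ] IsLast U u × IsFirst V v × Adj u v

-- The partition of an ordered cycle into two independent intervals is unique,
-- since a cycle is connected; hence quantifying it existentially is harmless.
IsBorderedCycle : OrderedGraph → Set
IsBorderedCycle G =
    IsCycle G
  × HasIntervalChromaticNumber G 2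
  × (Σ[ P ∈ IntervalPartition G 2 ] HasInnerBorder P × HasOuterBorder P)

-- The index n is the length of the cycle, so 𝒞ᴮ₂ⱼ is 𝓒ᴮ (2 * j).
𝓒ᴮ : ℕ → Pred OrderedGraph 0ℓ
𝓒ᴮ n G = order G ≡ n × IsBorderedCycle G

{-# OPTIONS --safe #-}
module Submission where

-- Say that an edge e is j-deep if it is the outer border of a bordered cycle of length
-- 2 + 2j(l − 1); every edge is 0-deep, an edge counting as a degenerate bordered 2-cycle.
-- A bordered cycle lies between its two borders, so two bordered cycles such that the outer
-- border of one is the inner border of the other have no further common vertex, and deleting
-- the common edge from their union leaves a bordered cycle.  Hence if the inner border of a
-- bordered 2l-cycle is j-deep, its outer border is (j+1)-deep, and the edges that are j-deep
-- but not (j+1)-deep form a 𝓒ᴮ(2l)-free graph.  With k − 1 = m(l − 1), an m-deep edge would be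
-- the outer border of a bordered 2k-cycle, so the classes j < m cover all edges, and the
-- largest one has at least |E(G)| / m of them.

open import Defs
open import Algebra.Properties.CommutativeSemigroup using (x∙yz≈y∙xz)
open import Data.Empty using (⊥-elim)
open import Data.Fin.Base as Fin using (Fin; zero; suc; toℕ) renaming (_≤_ to _≤ᶠ_; _<_ to _<ᶠ_)
import Data.Fin.Permutation as Perm
import Data.Fin.Properties as Fin
open import Data.List.Base using (List; []; _∷_; _++_; [_]; map; length; tabulate; lookup; filter; upTo; cartesianProduct; allFin)
open import Data.List.Extrema.Nat using (argmax; f[xs]≤f[argmax])
open import Data.List.Membership.Propositional using (_∈_)
import Data.List.Membership.DecPropositional as MembershipDec
open import Data.List.Membership.Propositional.Properties using (∈-++⁺ˡ; ∈-lookup; ∈-map⁺; ∈-upTo⁺)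
open import Data.List.Properties using (++-identityʳ; ++-assoc; tabulate-lookup; length-tabulate; length-++; length-map; filter-none)
open import Data.List.Relation.Binary.Permutation.Homogeneous using (onIndices)
open import Data.List.Relation.Binary.Permutation.Propositional using (_↭_; ↭-refl; ↭-prep; ↭-swap; ↭-sym; ↭-trans; ↭-reflexive; ↭⇒↭ₛ)
open import Data.List.Relation.Binary.Permutation.Propositional.Properties using (∷↭∷ʳ; shift; shifts; ++⁺ʳ; map⁺; ↭-length; All-resp-↭; ∈-resp-↭)
import Data.List.Relation.Binary.Permutation.Setoid.Properties as Permₛ
open import Data.List.Relation.Unary.All as All using (All; []; _∷_)
import Data.List.Relation.Unary.All.Properties as All
open import Data.List.Relation.Unary.AllPairs using ([]; _∷_)
open import Data.List.Relation.Unary.Any using (here; there)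
import Data.List.Relation.Unary.Sorted.TotalOrder.Properties as Sorted
open import Data.List.Relation.Unary.Unique.Propositional using (Unique)
import Data.List.Relation.Unary.Unique.DecPropositional as UniqueDec
import Data.List.Relation.Unary.Unique.Propositional.Properties as Unique
import Data.List.Sort as Sort
open import Data.Nat using (ℕ; zero; suc; _+_; _*_; _∸_; _≤_; _<_; s≤s; z≤n; s≤s⁻¹)
open import Data.Nat.Divisibility using (_∣_; divides)
import Data.Nat.Properties as ℕ
open import Data.Product using (_×_; _,_; Σ-syntax; ∃-syntax; swap; proj₁; proj₂)
import Data.Product.Properties as Product
open import Data.Sum as Sum using (_⊎_; inj₁; inj₂)
open import Function using (_∘_; id; mk⇔; _↔_; Inverse; Injective; Equivalence)
open import Relation.Binary using (DecTotalOrder; _Preserves_⟶_; Decidable)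
open import Relation.Binary.PropositionalEquality using (_≡_; refl; cong; cong₂; sym; trans; subst; subst₂; setoid)
open import Relation.Nullary using (Dec; yes; no; ¬_)
open import Relation.Nullary.Decidable using (map′; _×-dec_; _⊎-dec_; ¬?)
import Relation.Unary as Unary

-- Walks as lists of directed steps

private variable
  A B : Set

-- The edges of the walk from x to y whose list of intermediate vertices is zs.
steps : A → List A → A → List (A × A)
steps x []       y = [ (x , y) ]
steps x (z ∷ zs) y = (x , z) ∷ steps z zs y

steps-++ : ∀ (x : A) as z bs y →
  steps x (as ++ z ∷ bs) y ≡ steps x as z ++ steps z bs y
steps-++ x []       z bs y = refl
steps-++ x (a ∷ as) z bs y = cong ((x , a) ∷_) (steps-++ a as z bs y)

steps-map : ∀ (f : A → B) x zs y →
  steps (f x) (map f zs) (f y) ≡ map (λ (a , b) → f a , f b) (steps x zs y)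
steps-map f x []       y = refl
steps-map f x (z ∷ zs) y = cong ((f x , f z) ∷_) (steps-map f z zs y)

-- Reversal is tracked only up to permutation: lengths, uniqueness, `All` and membership, which are
-- what is later read off a walk, do not see the order of the list.
steps-reverse : ∀ (x : A) zs y →
  ∃[ rs ] rs ↭ zs × steps y rs x ↭ map swap (steps x zs y)
steps-reverse x []       y = [] , ↭-refl , ↭-refl
steps-reverse x (z ∷ zs) y with rs , rs↭ , steps↭ ← steps-reverse z zs y =
  rs ++ [ z ] ,
  ↭-trans (↭-sym (∷↭∷ʳ z rs)) (↭-prep z rs↭) ,
  ↭-trans (↭-reflexive (steps-++ y rs z [] x))
    (↭-trans (↭-sym (∷↭∷ʳ (z , x) _)) (↭-prep (z , x) steps↭))

-- `rest` collects the steps shared by the two walks, so a property of all old steps carries over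
-- once it is checked on the detour through `ws`.
steps-replace : ∀ {p q : A} x zs y → (p , q) ∈ steps x zs y → ∀ ws →
  ∃[ zs′ ] ∃[ rest ] zs′ ↭ ws ++ zs
    × steps x zs y ↭ (p , q) ∷ rest × steps x zs′ y ↭ steps p ws q ++ rest
steps-replace x [] y (here refl) ws =
  ws , [] , ↭-reflexive (sym (++-identityʳ ws)) , ↭-refl ,
  ↭-reflexive (sym (++-identityʳ _))
steps-replace x (z ∷ zs) y (here refl) ws =
  ws ++ z ∷ zs , steps z zs y , ↭-refl , ↭-refl ,
  ↭-reflexive (steps-++ x ws z zs y)
steps-replace {p = p} {q} x (z ∷ zs) y (there pq∈) ws
  with zs′ , rest , zs′↭ , old↭ , new↭ ← steps-replace z zs y pq∈ ws =
  z ∷ zs′ , (x , z) ∷ rest ,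
  ↭-trans (↭-prep z zs′↭) (↭-sym (shift z ws zs)) ,
  ↭-trans (↭-prep _ old↭) (↭-swap _ _ ↭-refl) ,
  ↭-trans (↭-prep _ new↭) (↭-sym (shift _ (steps p ws q) rest))

-- A closed walk is held as two arcs, from `x` to `y` and from `y` back to `x`. The induction moves
-- `x` from the head of the first arc to the end of the second until the step `(v , u)` comes first.
steps-rotate : ∀ {v u : A} x xs y ys → (v , u) ∈ steps x xs y →
  ∃[ zs ] u ∷ v ∷ zs ↭ x ∷ xs ++ y ∷ ys
    × (v , u) ∷ steps u zs v ↭ steps x xs y ++ steps y ys x
steps-rotate x [] y ys (here refl) = ys , ↭-swap _ _ ↭-refl , ↭-refl
steps-rotate x (z ∷ xs) y ys (here refl) =
  xs ++ y ∷ ys , ↭-swap _ _ ↭-refl ,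
  ↭-prep _ (↭-reflexive (steps-++ z xs y ys x))
steps-rotate x (z ∷ xs) y ys (there vu∈)
  with zs , verts↭ , steps↭ ← steps-rotate z xs y (ys ++ [ x ]) vu∈ =
  zs ,
  ↭-trans verts↭ (↭-trans (↭-reflexive (cong (z ∷_) (sym (++-assoc xs (y ∷ ys) [ x ]))))
    (↭-sym (∷↭∷ʳ x (z ∷ xs ++ y ∷ ys)))) ,
  ↭-trans steps↭ (↭-trans (↭-reflexive (trans
      (cong (steps z xs y ++_) (steps-++ y ys x [] z))
      (sym (++-assoc (steps z xs y) (steps y ys x) _))))
    (↭-sym (∷↭∷ʳ (x , z) (steps z xs y ++ steps y ys x))))

steps-tabulate⁺ : ∀ {n} (g : Fin (suc n) → A) y {i j} → suc (toℕ i) ≡ toℕ j →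
  (g i , g j) ∈ steps (g zero) (tabulate (g ∘ suc)) y
steps-tabulate⁺ {n = suc n} g y {zero} {suc zero} refl = here refl
steps-tabulate⁺ {n = suc n} g y {suc i} {suc j} eq =
  there (steps-tabulate⁺ (g ∘ suc) y (ℕ.suc-injective eq))

steps-tabulate-last⁺ : ∀ {n} (g : Fin (suc n) → A) y {i} → toℕ i ≡ n →
  (g i , y) ∈ steps (g zero) (tabulate (g ∘ suc)) y
steps-tabulate-last⁺ {n = zero}  g y {zero}  refl = here refl
steps-tabulate-last⁺ {n = suc n} g y {suc i} eq =
  there (steps-tabulate-last⁺ (g ∘ suc) y (ℕ.suc-injective eq))

steps-tabulate⁻ : ∀ {n} (g : Fin (suc n) → A) y {a b} →
  (a , b) ∈ steps (g zero) (tabulate (g ∘ suc)) y →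
  (∃[ i ] ∃[ j ] suc (toℕ i) ≡ toℕ j × a ≡ g i × b ≡ g j)
  ⊎ (∃[ i ] toℕ i ≡ n × a ≡ g i × b ≡ y)
steps-tabulate⁻ {n = zero}  g y (here refl) = inj₂ (zero , refl , refl , refl)
steps-tabulate⁻ {n = suc n} g y (here refl) = inj₁ (zero , suc zero , refl , refl , refl)
steps-tabulate⁻ {n = suc n} g y (there ab∈) with steps-tabulate⁻ (g ∘ suc) y ab∈
... | inj₁ (i , j , eq , a≡ , b≡) = inj₁ (suc i , suc j , cong suc eq , a≡ , b≡)
... | inj₂ (i , eq , a≡ , b≡)     = inj₂ (suc i , cong suc eq , a≡ , b≡)

-- The cyclic successor on `Fin n` and closed walks

-- The relation local to `CycleAdj`, under a name: `CycleAdj i j` unfolds to `Next i j ⊎ Next j i`.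
Next : ∀ {n} → Fin n → Fin n → Set
Next {n} i j = suc (toℕ i) ≡ toℕ j ⊎ (suc (toℕ i) ≡ n × toℕ j ≡ 0)

closedSteps : ∀ {n} → (Fin (suc n) → A) → List (A × A)
closedSteps g = steps (g zero) (tabulate (g ∘ suc)) (g zero)

closedSteps⁺ : ∀ {n} (g : Fin (suc n) → A) {i j} → Next i j →
  (g i , g j) ∈ closedSteps g
closedSteps⁺ g {j = j}    (inj₁ eq)       = steps-tabulate⁺ g (g zero) eq
closedSteps⁺ g {j = zero} (inj₂ (eq , _)) = steps-tabulate-last⁺ g (g zero) (ℕ.suc-injective eq)

closedSteps⁻ : ∀ {n} (g : Fin (suc n) → A) {a b} → (a , b) ∈ closedSteps g →
  ∃[ i ] ∃[ j ] Next i j × a ≡ g i × b ≡ g j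
closedSteps⁻ g ab∈ with steps-tabulate⁻ g (g zero) ab∈
... | inj₁ (i , j , eq , a≡ , b≡) = i , j , inj₁ eq , a≡ , b≡
... | inj₂ (i , eq , a≡ , b≡)     = i , zero , inj₂ (cong suc eq , refl) , a≡ , b≡

-- Enumerating a duplicate-free list in increasing order

lookup-injective : {xs : List A} → Unique xs → Injective _≡_ _≡_ (lookup xs)
lookup-injective (x∉ ∷ _) {zero}  {zero}  _  = refl
lookup-injective (x∉ ∷ _) {zero}  {suc j} eq = ⊥-elim (All.lookup x∉ (∈-lookup j) eq)
lookup-injective (x∉ ∷ _) {suc i} {zero}  eq = ⊥-elim (All.lookup x∉ (∈-lookup i) (sym eq))
lookup-injective (_ ∷ u)  {suc i} {suc j} eq = cong suc (lookup-injective u eq)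

Unique-resp-↭ : {xs ys : List A} → xs ↭ ys → Unique xs → Unique ys
Unique-resp-↭ xs↭ys = Permₛ.Unique-resp-↭ (setoid _) (↭⇒↭ₛ xs↭ys)

-- The list is sorted: `f` reads the sorted list, and `σ` sends a position in `xs` to its position
-- after sorting. When `xs` lists a cycle, this separates the vertex order from the order along the
-- cycle.
monotone-enumeration : ∀ {n} (xs : List (Fin n)) → Unique xs →
  Σ[ f ∈ (Fin (length xs) → Fin n) ] Σ[ σ ∈ Fin (length xs) ↔ Fin (length xs) ]
    Injective _≡_ _≡_ f × f Preserves _≤ᶠ_ ⟶ _≤ᶠ_
    × (∀ i → f (Inverse.to σ i) ≡ lookup xs i)
monotone-enumeration {n} xs xs! = f , σ , f-injective , f-mono , f∘σ
  where
  open Sort (Fin.≤-decTotalOrder n) using (sort; sort-↭; sort-↗)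
  xs↭ : xs ↭ sort xs
  xs↭ = ↭-sym (sort-↭ xs)
  len : length xs ≡ length (sort xs)
  len = ↭-length xs↭
  f : Fin (length xs) → Fin n
  f = lookup (sort xs) ∘ Fin.cast len
  π : Fin (length xs) ↔ Fin (length (sort xs))
  π = onIndices (↭⇒↭ₛ xs↭)
  σ : Fin (length xs) ↔ Fin (length xs)
  σ = π Perm.∘ₚ Perm.cast-id (sym len)
  f-injective : Injective _≡_ _≡_ f
  f-injective {i} {j} eq = Fin.toℕ-injective (trans (sym (Fin.toℕ-cast len i))
    (trans (cong toℕ (lookup-injective (Unique-resp-↭ xs↭ xs!) eq)) (Fin.toℕ-cast len j)))
  f-mono : f Preserves _≤ᶠ_ ⟶ _≤ᶠ_
  f-mono {i} {j} i≤j =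
    Sorted.lookup-mono-≤ (DecTotalOrder.totalOrder (Fin.≤-decTotalOrder n)) (sort-↗ xs)
      (subst₂ _≤_ (sym (Fin.toℕ-cast len i)) (sym (Fin.toℕ-cast len j)) i≤j)
  f∘σ : ∀ i → f (Inverse.to σ i) ≡ lookup xs i
  f∘σ i = trans (cong (lookup (sort xs)) (Fin.cast-involutive len (sym len) _))
    (sym (Permₛ.onIndices-lookup (setoid _) (↭⇒↭ₛ xs↭) i))

-- Realising a closed walk as an ordered cycle

cycleAdj? : ∀ {n} → Decidable (CycleAdj {n})
cycleAdj? {n} i j = next? i j ⊎-dec next? j i
  where
  next? : Decidable (Next {n})
  next? i j = (suc (toℕ i) ℕ.≟ toℕ j) ⊎-dec ((suc (toℕ i) ℕ.≟ n) ×-dec (toℕ j ℕ.≟ 0))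

next-irrefl : ∀ {n} → 2 ≤ n → (i : Fin n) → ¬ Next i i
next-irrefl 2≤n i (inj₁ eq) = ℕ.1+n≢n eq
next-irrefl 2≤n i (inj₂ (eq , i≡0)) =
  ℕ.1+n≰n (subst (2 ≤_) (trans (sym eq) (cong suc i≡0)) 2≤n)

-- `σ` lists the vertices along the cycle, so adjacency is tested on positions, through `from`.
cycleGraph : ∀ {n} → 2 ≤ n → (Fin n ↔ Fin n) → OrderedGraph
cycleGraph {n} 2≤n σ = record
  { order  = n
  ; Adj    = λ a b → CycleAdj (from a) (from b)
  ; adj?   = λ a b → cycleAdj? (from a) (from b)
  ; sym    = Sum.swap
  ; irrefl = λ { {a} refl → Sum.[ next-irrefl 2≤n (from a) , next-irrefl 2≤n (from a) ] }
  }
  where open Inverse σ using (from)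

cycleGraph-isCycle : ∀ {n} (2≤n : 2 ≤ n) (σ : Fin n ↔ Fin n) → 3 ≤ n →
  IsCycle (cycleGraph 2≤n σ)
cycleGraph-isCycle 2≤n σ 3≤n = 3≤n , σ , λ i j →
  mk⇔ (subst₂ CycleAdj (sym (strictlyInverseʳ i)) (sym (strictlyInverseʳ j)))
      (subst₂ CycleAdj (strictlyInverseʳ i) (strictlyInverseʳ j))
  where open Inverse σ

record CycleOn {n} (x : Fin n) (xs : List (Fin n)) : Set₁ where
  field
    graph         : OrderedGraph
    order-graph   : order graph ≡ suc (length xs)
    isCycle       : IsCycle graph
    emb           : Vertex graph → Fin n
    emb-injective : Injective _≡_ _≡_ emb
    emb-mono      : emb Preserves _≤ᶠ_ ⟶ _≤ᶠ_
    emb-∈         : ∀ w → emb w ∈ x ∷ xs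
    adj⇒step      : ∀ {a b} → OrderedGraph.Adj graph a b →
      (emb a , emb b) ∈ steps x xs x ⊎ (emb b , emb a) ∈ steps x xs x
    step⇒adj      : ∀ {a b} → (a , b) ∈ steps x xs x →
      ∃[ a′ ] ∃[ b′ ] emb a′ ≡ a × emb b′ ≡ b × OrderedGraph.Adj graph a′ b′

cycleOn : ∀ {n} (x : Fin n) xs → 2 ≤ length xs → Unique (x ∷ xs) → CycleOn x xs
cycleOn {n} x xs 2≤xs xs! with f , σ , f-injective , f-mono , f∘σ ← monotone-enumeration (x ∷ xs) xs! = record
  { graph         = H
  ; order-graph   = refl
  ; isCycle       = cycleGraph-isCycle (ℕ.m≤n⇒m≤1+n 2≤xs) σ (s≤s 2≤xs)
  ; emb           = f
  ; emb-injective = f-injective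
  ; emb-mono      = f-mono
  ; emb-∈         = λ w → subst (_∈ x ∷ xs) (sym (f≡ w)) (∈-lookup (from w))
  ; adj⇒step      = Sum.map next⇒step next⇒step
  ; step⇒adj      = step⇒adj
  }
  where
  open Inverse σ using (to; from; strictlyInverseˡ; strictlyInverseʳ)
  g : Fin (suc (length xs)) → Fin n
  g = lookup (x ∷ xs)
  H : OrderedGraph
  H = cycleGraph (ℕ.m≤n⇒m≤1+n 2≤xs) σ
  f≡ : ∀ w → f w ≡ g (from w)
  f≡ w = trans (cong f (sym (strictlyInverseˡ w))) (f∘σ (from w))
  steps≡ : closedSteps g ≡ steps x xs x
  steps≡ = cong (λ ys → steps x ys x) (tabulate-lookup xs)
  next⇒step : ∀ {a b} → Next (from a) (from b) → (f a , f b) ∈ steps x xs x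
  next⇒step {a} {b} ab =
    subst₂ _∈_ (sym (Product.×-≡,≡→≡ (f≡ a , f≡ b))) steps≡ (closedSteps⁺ g ab)
  step⇒adj : ∀ {a b} → (a , b) ∈ steps x xs x →
    ∃[ a′ ] ∃[ b′ ] f a′ ≡ a × f b′ ≡ b × OrderedGraph.Adj H a′ b′
  step⇒adj ab∈ with i , j , ij , a≡ , b≡ ← closedSteps⁻ g (subst (_ ∈_) (sym steps≡) ab∈) =
    to i , to j , trans (f∘σ i) (sym a≡) , trans (f∘σ j) (sym b≡) ,
    inj₁ (subst₂ Next (sym (strictlyInverseʳ i)) (sym (strictlyInverseʳ j)) ij)

-- Opening a cycle at an edge

-- The path left when the edge uv is removed from a cycle. The closing step `(v , u)` is kept apart
-- from `steps u mid v` because uv is going to be the outer border.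
record CutAt (H : OrderedGraph) (u v : Vertex H) : Set where
  open OrderedGraph H using (Adj)
  field
    mid         : List (Vertex H)
    mid-length  : 2 + length mid ≡ order H
    unique      : Unique (u ∷ v ∷ mid)
    step⇒adj    : All (λ (a , b) → Adj a b) (steps u mid v)
    adj⇒step    : ∀ {a b} → Adj a b →
      (a , b) ∈ (v , u) ∷ steps u mid v ⊎ (b , a) ∈ (v , u) ∷ steps u mid v

-- The enumeration `σ` runs through uv in one of two directions. Rotation brings that step to the
-- front; if it goes from `u` to `v`, the remaining path is reversed.
cutAt : ∀ H {u v} → IsCycle H → OrderedGraph.Adj H u v → CutAt H u v
cutAt H@record { order = suc (suc (suc n)) ; Adj = Adj ; sym = adj-sym } {u} {v}
  (s≤s (s≤s (s≤s _)) , σ , adj⇔) uv =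
  fromEdge (adj⇒closed uv)
  where
  open Inverse σ using (to; from; strictlyInverseˡ; strictlyInverseʳ)
  H₀ : List _
  H₀ = closedSteps to

  adj⇒closed : ∀ {a b} → Adj a b → (a , b) ∈ H₀ ⊎ (b , a) ∈ H₀
  adj⇒closed {a} {b} ab
    with Equivalence.from (adj⇔ (from a) (from b))
           (subst₂ Adj (sym (strictlyInverseˡ a)) (sym (strictlyInverseˡ b)) ab)
  ... | inj₁ ij = inj₁ (subst (_∈ H₀) (Product.×-≡,≡→≡ (strictlyInverseˡ a , strictlyInverseˡ b)) (closedSteps⁺ to ij))
  ... | inj₂ ji = inj₂ (subst (_∈ H₀) (Product.×-≡,≡→≡ (strictlyInverseˡ b , strictlyInverseˡ a)) (closedSteps⁺ to ji))

  closed⇒adj : All (λ (a , b) → Adj a b) H₀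
  closed⇒adj = All.tabulate λ ab∈ → next⇒adj (closedSteps⁻ to ab∈)
    where
    next⇒adj : ∀ {a b} → ∃[ i ] ∃[ j ] Next i j × a ≡ to i × b ≡ to j → Adj a b
    next⇒adj (i , j , ij , refl , refl) = Equivalence.to (adj⇔ i j) (inj₁ ij)

  vertices : List (Fin (3 + n))
  vertices = tabulate to

  vertices! : Unique vertices
  vertices! = Unique.tabulate⁺ λ {i} {j} eq →
    trans (sym (strictlyInverseʳ i)) (trans (cong from eq) (strictlyInverseʳ j))

  cut : ∀ {u v} → (v , u) ∈ H₀ →
    ∃[ zs ] u ∷ v ∷ zs ↭ vertices × (v , u) ∷ steps u zs v ↭ H₀
  cut (here refl) = _ , ↭-swap _ _ ↭-refl , ↭-refl
  -- After its first step the walk goes from `to (suc zero)` back to `to zero`; the first step alone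
  -- is the second arc, hence the empty list.
  cut (there vu∈) with zs , verts↭ , steps↭ ← steps-rotate (to (suc zero)) (tabulate (λ i → to (suc (suc i)))) (to zero) [] vu∈ =
    zs , ↭-trans verts↭ (↭-sym (∷↭∷ʳ _ _)) , ↭-trans steps↭ (↭-sym (∷↭∷ʳ _ _))

  IsEdgeList : List (Fin (3 + n) × Fin (3 + n)) → Set
  IsEdgeList es = All (λ (a , b) → Adj a b) es
    × (∀ {a b} → Adj a b → (a , b) ∈ es ⊎ (b , a) ∈ es)

  assemble : ∀ {es} zs → u ∷ v ∷ zs ↭ vertices → (v , u) ∷ steps u zs v ↭ es →
    IsEdgeList es → CutAt H u v
  assemble zs verts↭ steps↭ (es⇒adj , adj⇒es) = record
    { mid        = zs
    ; mid-length = trans (↭-length verts↭) (length-tabulate to)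
    ; unique     = Unique-resp-↭ (↭-sym verts↭) vertices!
    ; step⇒adj   = All.tail (All-resp-↭ (↭-sym steps↭) es⇒adj)
    ; adj⇒step   = λ ab → Sum.map (∈-resp-↭ (↭-sym steps↭)) (∈-resp-↭ (↭-sym steps↭)) (adj⇒es ab)
    }

  reversed-edges : IsEdgeList (map swap H₀)
  reversed-edges = All.map⁺ (All.map adj-sym closed⇒adj) ,
    λ ab → Sum.swap (Sum.map (∈-map⁺ swap) (∈-map⁺ swap) (adj⇒closed ab))

  fromEdge : (u , v) ∈ H₀ ⊎ (v , u) ∈ H₀ → CutAt H u v
  fromEdge (inj₂ vu∈) with zs , verts↭ , steps↭ ← cut vu∈ =
    assemble zs verts↭ steps↭ (closed⇒adj , adj⇒closed)
  fromEdge (inj₁ uv∈)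
    with zs , verts↭ , steps↭ ← cut uv∈
    with rs , rs↭ , rsteps↭ ← steps-reverse v zs u =
    assemble rs (↭-trans (↭-swap u v rs↭) verts↭)
      (↭-trans (↭-prep _ rsteps↭) (map⁺ swap steps↭)) reversed-edges

-- Bordered paths: decidability and gluing

-- Lists of a fixed length over `Fin n` form a finite search space. This makes depth decidable, and
-- with it adjacency in the class graphs.
∃-list? : ∀ {n} {P : List (Fin n) → Set} → (∀ xs → Dec (P xs)) →
  ∀ t → Dec (∃[ xs ] length xs ≡ t × P xs)
∃-list? P? zero = map′ (λ p → [] , refl , p) (λ { ([] , _ , p) → p }) (P? [])
∃-list? P? (suc t) =
  map′ (λ { (x , xs , eq , p) → x ∷ xs , cong suc eq , p })
       (λ { (x ∷ xs , eq , p) → x , xs , ℕ.suc-injective eq , p })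
       (Fin.any? λ x → ∃-list? (λ xs → P? (x ∷ xs)) t)

module _ {n : ℕ} where

  -- The two colour intervals of a bordered cycle with outer border uv and inner border pq.
  Between : (u p q v x : Fin n) → Set
  Between u p q v x = (u ≤ᶠ x × x ≤ᶠ p) ⊎ (q ≤ᶠ x × x ≤ᶠ v)

  -- Both directions are allowed, since a walk on a bordered cycle alternates between the two sides.
  Across : (p q x y : Fin n) → Set
  Across p q x y = (x ≤ᶠ p × q ≤ᶠ y) ⊎ (y ≤ᶠ p × q ≤ᶠ x)

  HasStep : (p q : Fin n) → List (Fin n × Fin n) → Set
  HasStep p q es = (p , q) ∈ es ⊎ (q , p) ∈ es

  HasStep-reverse : ∀ {p q es fs} → fs ↭ map swap es → HasStep p q es → HasStep p q fs
  HasStep-reverse fs↭ = Sum.swap ∘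
    Sum.map (∈-resp-↭ (↭-sym fs↭) ∘ ∈-map⁺ swap) (∈-resp-↭ (↭-sym fs↭) ∘ ∈-map⁺ swap)

module _ (G : OrderedGraph) where
  open OrderedGraph G using (Adj; adj?) renaming (sym to adj-sym)

  Crossing : (p q : Vertex G) → Vertex G × Vertex G → Set
  Crossing p q (x , y) = Adj x y × Across p q x y

  -- Together with the edge uv, a bordered cycle with outer border uv and inner border pq;
  -- with no intermediate vertices it degenerates to the single edge uv = pq.
  record IsBorderedPath (u v : Vertex G) (zs : List (Vertex G)) (p q : Vertex G) : Set where
    field
      unique   : Unique (u ∷ v ∷ zs)
      p<q      : p <ᶠ q
      u≤p      : u ≤ᶠ p
      q≤v      : q ≤ᶠ v
      between  : All (Between u p q v) (u ∷ v ∷ zs)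
      crossing : All (Crossing p q) (steps u zs v)
      inner    : HasStep p q (steps u zs v)

  isBorderedPath? : ∀ u v zs p q → Dec (IsBorderedPath u v zs p q)
  isBorderedPath? u v zs p q =
    map′ (λ (a , b , c , d , e , f , g) → record
           { unique = a ; p<q = b ; u≤p = c ; q≤v = d ; between = e ; crossing = f ; inner = g })
         (λ B → let open IsBorderedPath B in
           unique , p<q , u≤p , q≤v , between , crossing , inner)
      (unique? (u ∷ v ∷ zs)
        ×-dec p Fin.<? q ×-dec u Fin.≤? p ×-dec q Fin.≤? v
        ×-dec All.all? (λ x → (u Fin.≤? x ×-dec x Fin.≤? p) ⊎-dec (q Fin.≤? x ×-dec x Fin.≤? v)) (u ∷ v ∷ zs)
        ×-dec All.all? (λ (x , y) → adj? x y ×-dec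
                ((x Fin.≤? p ×-dec q Fin.≤? y) ⊎-dec (y Fin.≤? p ×-dec q Fin.≤? x))) (steps u zs v)
        ×-dec (((p , q) ∈? steps u zs v) ⊎-dec ((q , p) ∈? steps u zs v)))
    where
    open UniqueDec (Fin._≟_ {order G}) using (unique?)
    open MembershipDec (Product.≡-dec (Fin._≟_ {order G}) (Fin._≟_ {order G})) using (_∈?_)

  -- `t` counts intermediate vertices, so for positive `t` the edge uv closes such a path to a
  -- bordered cycle of length `2 + t`.
  BorderedPath : ℕ → Vertex G → Vertex G → Set
  BorderedPath t u v = ∃[ zs ] length zs ≡ t × ∃[ p ] ∃[ q ] IsBorderedPath u v zs p q

  borderedPath? : ∀ t u v → Dec (BorderedPath t u v)
  borderedPath? t u v =
    ∃-list? (λ zs → Fin.any? λ p → Fin.any? λ q → isBorderedPath? u v zs p q) t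

  edge⇒borderedPath : ∀ {u v} → u <ᶠ v → Adj u v → BorderedPath 0 u v
  edge⇒borderedPath {u} {v} u<v uv = [] , refl , u , v , record
    { unique   = (Fin.<⇒≢ u<v ∷ []) ∷ [] ∷ []
    ; p<q      = u<v
    ; u≤p      = Fin.≤-refl
    ; q≤v      = Fin.≤-refl
    ; between  = inj₁ (Fin.≤-refl , Fin.≤-refl) ∷ inj₂ (Fin.≤-refl , Fin.≤-refl) ∷ []
    ; crossing = (uv , inj₁ (Fin.≤-refl , Fin.≤-refl)) ∷ []
    ; inner    = inj₁ (here refl)
    }

  -- The outer path has no vertices strictly between p and q, whereas all intermediate
  -- vertices of the inner path are there; so replacing the step pq of the outer path by the
  -- inner path does not repeat a vertex.
  glue : ∀ {u v p q p₀ q₀ zs ws} →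
    IsBorderedPath u v zs p q → IsBorderedPath p q ws p₀ q₀ →
    ∃[ zs′ ] length zs′ ≡ length ws + length zs × IsBorderedPath u v zs′ p₀ q₀
  glue {u} {v} {p} {q} {p₀} {q₀} {zs} {ws} O I = Sum.[ along , against ] O.inner
    where
    module O = IsBorderedPath O
    module I = IsBorderedPath I

    ws! : Unique ws
    ws! with _ ∷ _ ∷ ws! ← I.unique = ws!

    -- If `x` were on the same side for both paths, it would be `p` or `q`, which uniqueness in the
    -- inner path excludes; opposite sides would contradict `p₀ <ᶠ q₀`.
    disjoint : ∀ {x} → ¬ (x ∈ ws × x ∈ u ∷ v ∷ zs)
    disjoint {x} (x∈ws , x∈) with (_ ∷ p≢) ∷ q≢ ∷ _ ← I.unique
      with All.lookup I.between (there (there x∈ws)) | All.lookup O.between x∈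
    ... | inj₁ (p≤x , _)  | inj₁ (_ , x≤p) = All.lookup p≢ x∈ws (Fin.≤-antisym p≤x x≤p)
    ... | inj₁ (_ , x≤p₀) | inj₂ (q≤x , _) =
      ℕ.<⇒≱ I.p<q (ℕ.≤-trans I.q≤v (ℕ.≤-trans q≤x x≤p₀))
    ... | inj₂ (q₀≤x , _) | inj₁ (_ , x≤p) =
      ℕ.<⇒≱ I.p<q (ℕ.≤-trans q₀≤x (ℕ.≤-trans x≤p I.u≤p))
    ... | inj₂ (_ , x≤q)  | inj₂ (q≤x , _) = All.lookup q≢ x∈ws (Fin.≤-antisym q≤x x≤q)

    between-outer : ∀ {x} → Between u p q v x → Between u p₀ q₀ v x
    between-outer (inj₁ (u≤x , x≤p)) = inj₁ (u≤x , ℕ.≤-trans x≤p I.u≤p)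
    between-outer (inj₂ (q≤x , x≤v)) = inj₂ (ℕ.≤-trans I.q≤v q≤x , x≤v)

    between-inner : ∀ {x} → Between p p₀ q₀ q x → Between u p₀ q₀ v x
    between-inner (inj₁ (p≤x , x≤p₀)) = inj₁ (ℕ.≤-trans O.u≤p p≤x , x≤p₀)
    between-inner (inj₂ (q₀≤x , x≤q)) = inj₂ (q₀≤x , ℕ.≤-trans x≤q O.q≤v)

    crossing-outer : ∀ {e} → Crossing p q e → Crossing p₀ q₀ e
    crossing-outer (xy , inj₁ (x≤p , q≤y)) = xy , inj₁ (ℕ.≤-trans x≤p I.u≤p , ℕ.≤-trans I.q≤v q≤y)
    crossing-outer (xy , inj₂ (y≤p , q≤x)) = xy , inj₂ (ℕ.≤-trans y≤p I.u≤p , ℕ.≤-trans I.q≤v q≤x)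

    -- The outer path may traverse pq in either direction; `ws′` stands for `ws` or its reversal
    -- accordingly.
    replace : ∀ {a b ws′} → (a , b) ∈ steps u zs v → ws′ ↭ ws →
      All (Crossing p₀ q₀) (steps a ws′ b) → HasStep p₀ q₀ (steps a ws′ b) →
      ∃[ zs′ ] length zs′ ≡ length ws + length zs × IsBorderedPath u v zs′ p₀ q₀
    replace {a} {b} {ws′} ab∈ ws′↭ crossing inner
      with zs′ , rest , zs′↭ , old↭ , new↭ ← steps-replace u zs v ab∈ ws′ =
      zs′ , trans (↭-length zs′↭ws++zs) (length-++ ws) , record
        { unique   = Unique-resp-↭ (↭-sym vertices↭) (Unique.++⁺ ws! O.unique disjoint)
        ; p<q      = I.p<q
        ; u≤p      = ℕ.≤-trans O.u≤p I.u≤p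
        ; q≤v      = ℕ.≤-trans I.q≤v O.q≤v
        ; between  = All-resp-↭ (↭-sym vertices↭)
            (All.++⁺ (All.map between-inner (All.tail (All.tail I.between)))
                     (All.map between-outer O.between))
        ; crossing = All-resp-↭ (↭-sym new↭) (All.++⁺ crossing
            (All.map crossing-outer (All.tail (All-resp-↭ old↭ O.crossing))))
        ; inner    = Sum.map (∈-resp-↭ (↭-sym new↭) ∘ ∈-++⁺ˡ) (∈-resp-↭ (↭-sym new↭) ∘ ∈-++⁺ˡ) inner
        }
      where
      zs′↭ws++zs : zs′ ↭ ws ++ zs
      zs′↭ws++zs = ↭-trans zs′↭ (++⁺ʳ zs ws′↭)
      vertices↭ : u ∷ v ∷ zs′ ↭ ws ++ u ∷ v ∷ zs
      vertices↭ = ↭-trans (↭-prep u (↭-prep v zs′↭ws++zs)) (shifts (u ∷ v ∷ []) ws)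

    along : (p , q) ∈ steps u zs v → _
    along pq∈ = replace pq∈ ↭-refl I.crossing I.inner

    against : (q , p) ∈ steps u zs v → _
    against qp∈ with rs , rs↭ , rsteps↭ ← steps-reverse p ws q =
      replace qp∈ rs↭
        (All-resp-↭ (↭-sym rsteps↭) (All.map⁺ (All.map (λ (xy , across) → adj-sym xy , Sum.swap across) I.crossing)))
        (HasStep-reverse rsteps↭ I.inner)

-- Passing between bordered cycles and bordered paths

module _ {G H : OrderedGraph} (embeds : H ⊑ G) where
  private
    module H = OrderedGraph H

  -- The outer border is not the inner one: otherwise u and v would be the only vertices.
  borderedCycle⇒path : IsCycle H → (P : IntervalPartition H 2) →
    HasInnerBorder P → HasOuterBorder P →
    ∃[ u ] ∃[ v ] ∃[ zs ] ∃[ p ] ∃[ q ] H.Adj p q × H.Adj u v × 2 + length zs ≡ order H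
      × IsBorderedPath G (proj₁ embeds u) (proj₁ embeds v) zs (proj₁ embeds p) (proj₁ embeds q)
  borderedCycle⇒path cyc P
    (p , q , (pU , p-last) , (qV , q-first) , pq) (u , v , (uU , u-first) , (vV , v-last) , uv) =
    u , v , map f mid , p , q , pq , uv , trans (cong (2 +_) (length-map f mid)) mid-length , record
      { unique   = Unique.map⁺ f-injective unique
      ; p<q      = Fin.≤∧≢⇒< (f-mono p≤q) λ fp≡fq →
          H.irrefl (f-injective fp≡fq) pq
      ; u≤p      = f-mono (u-first p pU)
      ; q≤v      = f-mono (v-last q qV)
      ; between  = All.map⁺ (All.universal between (u ∷ v ∷ mid))
      ; crossing = subst (All _) (sym (steps-map f u mid v)) (All.map⁺ (All.map crossing step⇒adj))
      ; inner    = subst (HasStep (f p) (f q)) (sym (steps-map f u mid v)) (Sum.map (∈-map⁺ _) (∈-map⁺ _) inner)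
      }
    where
    open IntervalPartition P
    open CutAt (cutAt H cyc uv)
    f = proj₁ embeds
    f-injective = proj₁ (proj₂ embeds)
    f-mono = proj₁ (proj₂ (proj₂ embeds))
    f-adj = proj₂ (proj₂ (proj₂ embeds))

    side : ∀ w → part w ≡ zero ⊎ part w ≡ suc zero
    side w with part w
    ... | zero     = inj₁ refl
    ... | suc zero = inj₂ refl

    p≤q : p ≤ᶠ q
    p≤q with Fin.≤-total p q
    ... | inj₁ p≤q = p≤q
    ... | inj₂ q≤p with () ← subst₂ _≤ᶠ_ qV pU (monotone q≤p)

    between : ∀ w → Between (f u) (f p) (f q) (f v) (f w)
    between w = Sum.map
      (λ wU → f-mono (u-first w wU) , f-mono (p-last w wU))
      (λ wV → f-mono (q-first w wV) , f-mono (v-last w wV)) (side w)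

    crossing : ∀ {e} → H.Adj (proj₁ e) (proj₂ e) → Crossing G (f p) (f q) (f (proj₁ e) , f (proj₂ e))
    crossing {x , y} xy with side x | side y
    ... | inj₁ xU | inj₁ yU = ⊥-elim (independent (trans xU (sym yU)) xy)
    ... | inj₁ xU | inj₂ yV = f-adj xy , inj₁ (f-mono (p-last x xU) , f-mono (q-first y yV))
    ... | inj₂ xV | inj₁ yU = f-adj xy , inj₂ (f-mono (p-last y yU) , f-mono (q-first x xV))
    ... | inj₂ xV | inj₂ yV = ⊥-elim (independent (trans xV (sym yV)) xy)

    inner : HasStep p q (steps u mid v)
    inner with adj⇒step pq
    ... | inj₁ (there pq∈)  = inj₁ pq∈
    ... | inj₂ (there qp∈)  = inj₂ qp∈
    ... | inj₁ (here refl)  with () ← trans (sym pU) vV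
    ... | inj₂ (here refl)  with mid | mid-length | unique
    ...   | []     | eq | _ = ⊥-elim (ℕ.<⇒≱ (proj₁ cyc) (ℕ.≤-reflexive (sym eq)))
    ...   | w ∷ ws | _  | (_ ∷ u≢w ∷ _) ∷ (v≢w ∷ _) ∷ _ with side w
    ...     | inj₁ wU = ⊥-elim (u≢w (Fin.≤-antisym (u-first w wU) (p-last w wU)))
    ...     | inj₂ wV = ⊥-elim (v≢w (Fin.≤-antisym (q-first w wV) (v-last w wV)))

-- The edge uv closes the path, and `1 ≤ t` supplies the third vertex that a cycle needs. Every step
-- crosses the gap between `p` and `q`, so the two sides of the gap are the two independent
-- intervals.
borderedPath⇒borderedCycle : ∀ G {u v t} → 1 ≤ t → OrderedGraph.Adj G u v →
  BorderedPath G t u v → ∃[ H ] 𝓒ᴮ (2 + t) H × H ⊑ G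
borderedPath⇒borderedCycle G {u} {v} 1≤t uv (zs , refl , p , q , B) =
  H , (order-graph , isCycle , (partition , minimal) , partition , innerBorder , outerBorder) ,
  emb , emb-injective , emb-mono , adj⇒Adj
  where
  module G = OrderedGraph G
  open IsBorderedPath B
  -- The list starts at `v`, so the closing step `(v , u)` comes first and the tail is
  -- `steps u zs v`.
  open CycleOn (cycleOn v (u ∷ zs) (s≤s 1≤t) (Unique-resp-↭ (↭-swap u v ↭-refl) unique))
    renaming (graph to H)
  module H = OrderedGraph H

  crossing-closed : All (Crossing G p q) ((v , u) ∷ steps u zs v)
  crossing-closed = (G.sym uv , inj₂ (u≤p , q≤v)) ∷ crossing

  crosses : ∀ {a b} → H.Adj a b → Crossing G p q (emb a , emb b)
  crosses ab with adj⇒step ab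
  ... | inj₁ e∈ = All.lookup crossing-closed e∈
  ... | inj₂ e∈ with ba , across ← All.lookup crossing-closed e∈ = G.sym ba , Sum.swap across

  adj⇒Adj : ∀ {a b} → H.Adj a b → G.Adj (emb a) (emb b)
  adj⇒Adj ab = proj₁ (crosses ab)

  emb-between : ∀ w → Between u p q v (emb w)
  emb-between w = All.lookup between (∈-resp-↭ (↭-swap v u ↭-refl) (emb-∈ w))

  emb-injective-≤ : ∀ {a b} → emb a ≤ᶠ emb b → a ≤ᶠ b
  emb-injective-≤ {a} {b} a≤b with Fin.≤-total a b
  ... | inj₁ le = le
  ... | inj₂ ge = Fin.≤-reflexive (emb-injective (Fin.≤-antisym a≤b (emb-mono ge)))

  emb-reflects-≤ : ∀ {a b x y} → emb a ≡ x → emb b ≡ y → x ≤ᶠ y → a ≤ᶠ b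
  emb-reflects-≤ refl refl = emb-injective-≤

  sideOf : ∀ {w} → Between u p q v w → Fin 2
  sideOf (inj₁ _) = zero
  sideOf (inj₂ _) = suc zero

  -- The side is read off the proof of `Between`; since `p <ᶠ q`, its two alternatives exclude each
  -- other, so `part` depends on the position of `emb w` only.
  part : Vertex H → Fin 2
  part w = sideOf (emb-between w)

  leftPart : ∀ w → part w ≡ zero → u ≤ᶠ emb w × emb w ≤ᶠ p
  leftPart w eq with emb-between w
  ... | inj₁ b = b

  rightPart : ∀ w → part w ≡ suc zero → q ≤ᶠ emb w × emb w ≤ᶠ v
  rightPart w eq with emb-between w
  ... | inj₂ b = b

  part-left : ∀ {w} → emb w ≤ᶠ p → part w ≡ zero
  part-left {w} w≤p with emb-between w
  ... | inj₁ _ = refl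
  ... | inj₂ (q≤w , _) = ⊥-elim (ℕ.<⇒≱ p<q (ℕ.≤-trans q≤w w≤p))

  part-right : ∀ {w} → q ≤ᶠ emb w → part w ≡ suc zero
  part-right {w} q≤w with emb-between w
  ... | inj₁ (_ , w≤p) = ⊥-elim (ℕ.<⇒≱ p<q (ℕ.≤-trans q≤w w≤p))
  ... | inj₂ _ = refl

  innerEdge : ∃[ a ] ∃[ b ] emb a ≡ p × emb b ≡ q × H.Adj a b
  innerEdge with inner
  ... | inj₁ pq∈ = step⇒adj (there pq∈)
  ... | inj₂ qp∈ with b , a , eb , ea , ba ← step⇒adj (there qp∈) = a , b , ea , eb , H.sym ba

  p′ q′ : Vertex H
  p′ = proj₁ innerEdge
  q′ = proj₁ (proj₂ innerEdge)
  emb-p : emb p′ ≡ p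
  emb-p = proj₁ (proj₂ (proj₂ innerEdge))
  emb-q : emb q′ ≡ q
  emb-q = proj₁ (proj₂ (proj₂ (proj₂ innerEdge)))
  pq′ : H.Adj p′ q′
  pq′ = proj₂ (proj₂ (proj₂ (proj₂ innerEdge)))

  p′-left : part p′ ≡ zero
  p′-left = part-left (Fin.≤-reflexive emb-p)
  q′-right : part q′ ≡ suc zero
  q′-right = part-right (Fin.≤-reflexive (sym emb-q))

  partition : IntervalPartition H 2
  partition = record
    { part        = part
    ; monotone    = monotone
    ; nonempty    = λ { zero → p′ , p′-left ; (suc zero) → q′ , q′-right }
    ; independent = independent
    }
    where
    monotone : part Preserves _≤ᶠ_ ⟶ _≤ᶠ_
    monotone {a} {b} a≤b with emb-between a | emb-between b
    ... | inj₁ _ | _      = z≤n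
    ... | inj₂ _ | inj₂ _ = ℕ.≤-refl
    ... | inj₂ (q≤a , _) | inj₁ (_ , b≤p) =
      ⊥-elim (ℕ.<⇒≱ p<q (ℕ.≤-trans q≤a (ℕ.≤-trans (emb-mono a≤b) b≤p)))
    independent : ∀ {a b} → part a ≡ part b → ¬ H.Adj a b
    independent {a} {b} eq ab with crosses ab
    ... | _ , inj₁ (a≤p , q≤b) with () ← trans (sym (part-left a≤p)) (trans eq (part-right q≤b))
    ... | _ , inj₂ (b≤p , q≤a) with () ← trans (sym (part-left b≤p)) (trans (sym eq) (part-right q≤a))

  minimal : ∀ d → IntervalPartition H d → 2 ≤ d
  minimal zero P with () ← IntervalPartition.part P p′
  minimal (suc zero) P = ⊥-elim (independent (all-equal (part₁ p′) (part₁ q′)) pq′)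
    where
    open IntervalPartition P using (independent) renaming (part to part₁)
    all-equal : (i j : Fin 1) → i ≡ j
    all-equal zero zero = refl
  minimal (suc (suc d)) P = s≤s (s≤s z≤n)

  innerBorder : HasInnerBorder partition
  innerBorder = p′ , q′ ,
    (p′-left , λ w eq → emb-reflects-≤ refl emb-p (proj₂ (leftPart w eq))) ,
    (q′-right , λ w eq → emb-reflects-≤ emb-q refl (proj₁ (rightPart w eq))) ,
    pq′

  outerBorder : HasOuterBorder partition
  outerBorder with v′ , u′ , emb-v , emb-u , vu′ ← step⇒adj (here refl) = u′ , v′ ,
    (part-left (subst (_≤ᶠ p) (sym emb-u) u≤p) ,
      λ w eq → emb-reflects-≤ emb-u refl (proj₁ (leftPart w eq))) ,
    (part-right (subst (q ≤ᶠ_) (sym emb-v) q≤v) ,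
      λ w eq → emb-reflects-≤ refl emb-v (proj₂ (rightPart w eq))) ,
    H.sym vu′

-- A union bound for filtered lists

module _ {A : Set} {P : A → Set} (P? : Unary.Decidable P) where

  length-filter-⊎ : ∀ {Q R : A → Set} (Q? : Unary.Decidable Q) (R? : Unary.Decidable R) →
    (∀ {x} → P x → Q x ⊎ R x) → ∀ xs →
    length (filter P? xs) ≤ length (filter Q? xs) + length (filter R? xs)
  length-filter-⊎ Q? R? cover [] = z≤n
  length-filter-⊎ Q? R? cover (x ∷ xs) with ih ← length-filter-⊎ Q? R? cover xs | P? x | Q? x | R? x
  ... | yes p | yes q | yes r = s≤s (ℕ.≤-trans ih (ℕ.+-monoʳ-≤ _ (ℕ.n≤1+n _)))
  ... | yes p | yes q | no ¬r = s≤s ih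
  ... | yes p | no ¬q | yes r = ℕ.≤-trans (s≤s ih) (ℕ.≤-reflexive (sym (ℕ.+-suc _ _)))
  ... | yes p | no ¬q | no ¬r = ⊥-elim (Sum.[ ¬q , ¬r ] (cover p))
  ... | no ¬p | yes q | yes r = ℕ.m≤n⇒m≤1+n (ℕ.≤-trans ih (ℕ.+-monoʳ-≤ _ (ℕ.n≤1+n _)))
  ... | no ¬p | yes q | no ¬r = ℕ.m≤n⇒m≤1+n ih
  ... | no ¬p | no ¬q | yes r = ℕ.≤-trans ih (ℕ.+-monoʳ-≤ _ (ℕ.n≤1+n _))
  ... | no ¬p | no ¬q | no ¬r = ih

-- The last class is split off, and what it misses is covered by the earlier ones. `P` varies in the
-- induction because it shrinks to the part not yet covered.
length-filter-cover : ∀ {A : Set} {P : A → Set} {Q : ℕ → A → Set}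
  (P? : Unary.Decidable P) (Q? : ∀ j → Unary.Decidable (Q j)) m xs {M} →
  (∀ {x} → P x → ∃[ j ] j < m × Q j x) →
  (∀ {j} → j < m → length (filter (Q? j) xs) ≤ M) →
  length (filter P? xs) ≤ m * M
length-filter-cover P? Q? zero xs cover bound =
  ℕ.≤-reflexive (cong length (filter-none P? {xs}
    (All.universal (λ _ Px → ℕ.n≮0 (proj₁ (proj₂ (cover Px)))) xs)))
length-filter-cover {P = P} {Q} P? Q? (suc m) xs cover bound = ℕ.≤-trans
  (length-filter-⊎ P? (Q? m) P∖Q? split xs)
  (ℕ.+-mono-≤ (bound ℕ.≤-refl) (length-filter-cover P∖Q? Q? m xs rest (bound ∘ ℕ.m≤n⇒m≤1+n)))
  where
  P∖Q? : Unary.Decidable (λ x → P x × ¬ Q m x)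
  P∖Q? x = P? x ×-dec ¬? (Q? m x)
  split : ∀ {x} → P x → Q m x ⊎ (P x × ¬ Q m x)
  split {x} Px with Q? m x
  ... | yes q = inj₁ q
  ... | no ¬q = inj₂ (Px , ¬q)
  rest : ∀ {x} → P x × ¬ Q m x → ∃[ j ] j < m × Q j x
  rest (Px , ¬q) with j , j<1+m , q ← cover Px =
    j , ℕ.≤∧≢⇒< (s≤s⁻¹ j<1+m) (λ { refl → ¬q q }) , q

-- Subgraphs given by a choice of edges

-- `C` is read at increasing pairs only and then symmetrised, because depth is a property of an edge
-- with its left endpoint named first.
restrict : (G : OrderedGraph) {C : Vertex G → Vertex G → Set} → Decidable C → OrderedGraph
restrict G {C} C? = record
  { order  = order G
  ; Adj    = λ u v → Adj u v × Chosen u v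
  ; adj?   = λ u v → adj? u v ×-dec
      ((u Fin.<? v ×-dec C? u v) ⊎-dec (v Fin.<? u ×-dec C? v u))
  ; sym    = λ (uv , c) → adj-sym uv , Sum.swap c
  ; irrefl = λ eq (uv , _) → irrefl eq uv
  }
  where
  open OrderedGraph G using (Adj; adj?; irrefl) renaming (sym to adj-sym)
  Chosen : Vertex G → Vertex G → Set
  Chosen u v = (u <ᶠ v × C u v) ⊎ (v <ᶠ u × C v u)

restrict⇒chosen : ∀ G {C : Vertex G → Vertex G → Set} (C? : Decidable C) {u v} →
  u <ᶠ v → OrderedGraph.Adj (restrict G C?) u v → C u v
restrict⇒chosen G C? u<v (_ , inj₁ (_ , c))   = c
restrict⇒chosen G C? u<v (_ , inj₂ (v<u , _)) = ⊥-elim (ℕ.<-asym u<v v<u)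

restrict-⊑ : ∀ G {C : Vertex G → Vertex G → Set} (C? : Decidable C) → restrict G C? ⊑ G
restrict-⊑ G C? = id , id , id , proj₁

⊑-trans : ∀ {F G H} → F ⊑ G → G ⊑ H → F ⊑ H
⊑-trans (f , f-inj , f-mono , f-adj) (g , g-inj , g-mono , g-adj) =
  g ∘ f , f-inj ∘ g-inj , g-mono ∘ f-mono , g-adj ∘ f-adj

-- Classes of edges by depth, and the largest class

-- The search descends from `m` and stops at the first success, just below a failure. It places each
-- edge in some class.
last-true : ∀ {P : ℕ → Set} → Unary.Decidable P → P 0 → ∀ m → ¬ P m →
  ∃[ j ] j < m × P j × ¬ P (suc j)
last-true P? P0 zero    ¬Pm = ⊥-elim (¬Pm P0)
last-true P? P0 (suc m) ¬Pm with P? m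
... | yes Pm = m , ℕ.≤-refl , Pm , ¬Pm
... | no ¬Pm with j , j<m , c ← last-true P? P0 m ¬Pm = j , ℕ.m≤n⇒m≤1+n j<m , c

module _ (G : OrderedGraph) (d : ℕ) where
  open OrderedGraph G using (Adj; adj?)

  -- For `d` equal to twice l - 1, `BorderedPath G (j * d) u v` says that the edge uv is j-deep.
  Class : ℕ → Vertex G → Vertex G → Set
  Class j u v = BorderedPath G (j * d) u v × ¬ BorderedPath G (suc j * d) u v

  class? : ∀ j → Decidable (Class j)
  class? j u v = borderedPath? G (j * d) u v ×-dec ¬? (borderedPath? G (suc j * d) u v)

  classGraph : ℕ → OrderedGraph
  classGraph j = restrict G (class? j)

  classGraph-free : ∀ j → (𝓒ᴮ (2 + d) -Free) (classGraph j)
  classGraph-free j C (|C|≡2+d , cyc , _ , P , innerBorder , outerBorder) C⊑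
    with u , v , zs , p , q , pq , uv , |zs| , O ←
      borderedCycle⇒path {G} {C} (⊑-trans {C} {classGraph j} {G} C⊑ (restrict-⊑ G (class? j)))
        cyc P innerBorder outerBorder
    -- The inner border is an edge of the class graph, hence j-deep: it carries a bordered path `I`
    -- in `G`.
    with (ws , |ws| , p₀ , q₀ , I) , _ ←
      restrict⇒chosen G (class? j) (IsBorderedPath.p<q O) (proj₂ (proj₂ (proj₂ C⊑)) pq)
    with zs′ , |zs′| , glued ← glue G O I =
    -- The outer border belongs to the same class, so it is not (j+1)-deep; yet the glued path has
    -- `j * d + d` intermediate vertices, which is `suc j * d` after commuting.
    proj₂ (restrict⇒chosen G (class? j) u<v (proj₂ (proj₂ (proj₂ C⊑)) uv))
      (zs′ , trans |zs′| (trans (ℕ.+-comm (length ws) _) (cong₂ _+_ |zs|≡d |ws|)) , p₀ , q₀ , glued)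
    where
    open IsBorderedPath O using (u≤p; p<q; q≤v)
    u<v = ℕ.<-≤-trans (ℕ.≤-<-trans u≤p p<q) q≤v
    |zs|≡d = ℕ.suc-injective (ℕ.suc-injective (trans |zs| |C|≡2+d))

  classGraph-edges : ∀ m → (∀ {u v} → Adj u v → ¬ BorderedPath G (m * d) u v) →
    ∃[ j ] #edges G ≤ m * #edges (classGraph j)
  classGraph-edges m none = j ,
    length-filter-cover (λ (u , v) → u Fin.<? v ×-dec adj? u v)
      (λ i (u , v) → u Fin.<? v ×-dec OrderedGraph.adj? (classGraph i) u v)
      m (cartesianProduct (allFin (order G)) (allFin (order G))) cover bound
    where
    j : ℕ
    -- The default 0 is itself below `m` when `m` is positive. For `m` equal to 0 the claim is that
    -- `G` has no edges, and `none` contradicts the 0-depth of any edge.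
    j = argmax (#edges ∘ classGraph) 0 (upTo m)
    cover : ∀ {e@(u , v) : Vertex G × Vertex G} → u <ᶠ v × Adj u v →
      ∃[ i ] i < m × u <ᶠ v × OrderedGraph.Adj (classGraph i) u v
    cover {u , v} (u<v , uv)
      -- Every edge is 0-deep and, by `none`, not m-deep.
      with i , i<m , c ← last-true (λ i → borderedPath? G (i * d) u v)
                           (edge⇒borderedPath G u<v uv) m (none uv) =
      i , i<m , u<v , uv , inj₁ (u<v , c)
    bound : ∀ {i} → i < m → #edges (classGraph i) ≤ #edges (classGraph j)
    bound i<m = All.lookup (f[xs]≤f[argmax] 0 (upTo m)) (∈-upTo⁺ i<m)

theorem4 : (k l : ℕ) → 2 ≤ k → 2 ≤ l → (l ∸ 1) ∣ (k ∸ 1) →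
    (G : OrderedGraph) → (𝓒ᴮ (2 * k) -Free) G →
    Σ[ H ∈ OrderedGraph ]
    H ⊑ G × (𝓒ᴮ (2 * l) -Free) H × (l ∸ 1) * #edges G ≤ (k ∸ 1) * #edges H
theorem4 (suc k) (suc l) (s≤s 1≤k) _ (divides m k≡ml) G G-free =
  H , restrict-⊑ G (class? G (2 * l) j) ,
  -- After matching, `k` and `l` denote the predecessors of the given numbers, so the forbidden
  -- length `2 * suc l` is `2 + 2 * l`, and `d` is `2 * l`.
  subst (λ n → (𝓒ᴮ n -Free) H) (sym (ℕ.*-suc 2 l)) (classGraph-free G (2 * l) j) ,
  (begin
    l * #edges G        ≤⟨ ℕ.*-monoʳ-≤ l (proj₂ largest) ⟩
    l * (m * #edges H)  ≡⟨ ℕ.*-assoc l m (#edges H) ⟨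
    (l * m) * #edges H  ≡⟨ cong (_* #edges H) (trans (ℕ.*-comm l m) (sym k≡ml)) ⟩
    k * #edges H        ∎)
  where
  open ℕ.≤-Reasoning
  -- As `m * (2 * l)` equals `2 * k`, an m-deep edge would close a bordered cycle of length
  -- `2 + 2 * k`, the length forbidden in `G`.
  noPath : ∀ {u v} → OrderedGraph.Adj G u v → ¬ BorderedPath G (m * (2 * l)) u v
  noPath {u} {v} uv path
    with C , C-bordered , C⊑G ← borderedPath⇒borderedCycle G (ℕ.≤-trans 1≤k (ℕ.m≤n*m k 2)) uv
           (subst (λ t → BorderedPath G t u v)
             (trans (x∙yz≈y∙xz ℕ.*-commutativeSemigroup m 2 l) (cong (2 *_) (sym k≡ml))) path) =
    G-free C (subst (λ n → 𝓒ᴮ n C) (sym (ℕ.*-suc 2 k)) C-bordered) C⊑G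
  largest : ∃[ j ] #edges G ≤ m * #edges (classGraph G (2 * l) j)
  largest = classGraph-edges G (2 * l) m noPath
  j = proj₁ largest
  H = classGraph G (2 * l) j
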